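{- The cycle index of the $3$-group $S_7^{(3)}$ of the symmetric group $S_7$, i.e. of the action of $S_7$ on the $35$ three-element subsets of $\{1,\dots,7\}$, in the variables $a_1,a_2,\dots$, is \begin{align*} Z(S_7^{(3)}) = \frac{1}{7!} \big(& a_{1}^{35} + 21 a_{1}^{15} a_{2}^{10} + 105 a_{1}^{7} a_{2}^{14} + 70 a_{1}^{5} a_{3}^{10} + 105 a_{1}^{3} a_{2}^{16} \\ & + 420 a_{1}^{3} a_{2} a_{3}^{4} a_{6}^{3} + 280 a_{1}^{2} a_{3}^{11} + 420 a_{1} a_{4} a_{6} a_{12}^{2} + 840 a_{1} a_{2}^{3} a_{4}^{7} \\ & + 210 a_{1} a_{2}^{2} a_{3}^{2} a_{6}^{4} + 504 a_{5}^{3} a_{10}^{2} + 840 a_{2} a_{3} a_{6}^{5} + 504 a_{5}^{7} + 720 a_{7}^{5}\big). \end{align*}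
   Context: For a permutation group $A$ on a finite set, and $\alpha\in A$, let $j_k(\alpha)$ be the number of cycles of length $k$ in the disjoint cycle decomposition of $\alpha$ (fixed points counted as cycles of length $1$). The cycle index of $A$ is the polynomial $Z(A)=\frac{1}{|A|}\sum_{\alpha\in A}\prod_{k} a_k^{j_k(\alpha)}$ in the variables $a_1,a_2,\dots$ with rational coefficients. For $1\le r\le p$, $S_p^{(r)}$ (the $r$-group of $S_p$) is the permutation group on the set of $r$-element subsets of $\{1,\dots,p\}$ formed by the permutations $\alpha'$ induced by $\alpha\in S_p$ via $\alpha'\{i_1,\dots,i_r\}=\{\alpha i_1,\dots,\alpha i_r\}$. -}

module Defs where

open import Algebra.Bundles using (CommutativeRing; CommutativeSemiring)
import Algebra.Definitions.RawSemiring as RawSemiringDefs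
import Algebra.Properties.CommutativeMonoid.Sum as CommutativeMonoidSum
open import Data.Bool.Base using (Bool; true; false; if_then_else_)
import Data.Bool.Properties as Bool
open import Data.Empty using (⊥)
open import Data.Fin.Base using (Fin; zero; suc; punchIn)
open import Data.Fin.Permutation as Perm using (Permutation′; _⟨$⟩ʳ_; _⟨$⟩ˡ_)
open import Data.Fin.Subset using (Subset; inside; outside; _∈_; ∣_∣)
open import Data.Integer.Base using (+_)
open import Data.List.Base using (List; []; _∷_; _++_; length; map; concat; cartesianProductWith; allFin; upTo; filter; foldr; deduplicate)
import Data.List.Membership.DecPropositional as DecMembership
import Data.List.Membership.Propositional as ∈ₗ
open import Data.List.Membership.Propositional.Properties using (∈-map⁺; ∈-map⁻; ∈-++⁺ˡ; ∈-++⁺ʳ; ∈-allFin)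
import Data.List.Membership.Setoid as SetoidMembership
import Data.List.Membership.Setoid.Properties as SetoidMembershipₚ
open import Data.List.Relation.Unary.All as All using ()
open import Data.List.Relation.Unary.Any as Any using (Any; here; there)
open import Data.List.Relation.Unary.AllPairs using ([]; _∷_)
open import Data.List.Relation.Unary.Unique.Propositional using (Unique)
import Data.List.Relation.Unary.Unique.Propositional.Properties as Uniqueₚ
import Data.List.Relation.Unary.Any.Properties as Anyₚ
import Data.List.Relation.Unary.Unique.Setoid as SetoidUnique
import Data.List.Relation.Unary.Unique.DecSetoid.Properties as DecUniqueₚ
open import Data.Nat.Base as ℕ using (ℕ; zero; suc; NonZero)
import Data.Nat.Properties as ℕ
open import Data.Product.Base using (Σ; ∃; _×_; _,_; proj₁; proj₂)
open import Data.Rational.Base as ℚ using (ℚ; 0ℚ; 1ℚ)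
import Data.Rational.Properties as ℚ
open import Data.Vec.Base using ([]; _∷_; lookup; tabulate)
import Data.Vec.Properties as Vec
open import Function.Base using (_∘_)
open import Function.Bundles using (_↔_; Inverse; mk↔ₛ′; _⇔_; mk⇔; Equivalence)
open import Function.Construct.Composition using (_↔-∘_)
open import Function.Construct.Identity using (↔-id)
open import Function.Construct.Symmetry using (↔-sym)
open import Level using (0ℓ)
open import Relation.Binary.Bundles using (Setoid; DecSetoid)
open import Relation.Binary.Definitions using (DecidableEquality)
open import Relation.Binary.PropositionalEquality
open import Relation.Nullary.Decidable using (Dec; does; map′)

infixl 5 _⊕_
infixl 7 _⊗_
infix  4 _≋_

-- The free commutative ℚ-algebra on a₁, a₂, …: polynomial expressions modulo
-- the congruence _≋_ generated by the commutative ring laws and by the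
-- requirement that con : ℚ → ℚ[a] is a ring homomorphism.
data ℚ[a] : Set where
  con     : ℚ → ℚ[a]
  a       : (k : ℕ) → .{{NonZero k}} → ℚ[a]
  _⊕_ _⊗_ : ℚ[a] → ℚ[a] → ℚ[a]

data _≋_ : ℚ[a] → ℚ[a] → Set where
  ≋-refl  : ∀ {p} → p ≋ p
  ≋-sym   : ∀ {p q} → p ≋ q → q ≋ p
  ≋-trans : ∀ {p q r} → p ≋ q → q ≋ r → p ≋ r

  ⊕-cong  : ∀ {p p′ q q′} → p ≋ p′ → q ≋ q′ → p ⊕ q ≋ p′ ⊕ q′
  ⊗-cong  : ∀ {p p′ q q′} → p ≋ p′ → q ≋ q′ → p ⊗ q ≋ p′ ⊗ q′

  ⊕-assoc : ∀ p q r → (p ⊕ q) ⊕ r ≋ p ⊕ (q ⊕ r)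
  ⊕-comm  : ∀ p q → p ⊕ q ≋ q ⊕ p
  ⊕-idˡ   : ∀ p → con 0ℚ ⊕ p ≋ p
  ⊗-assoc : ∀ p q r → (p ⊗ q) ⊗ r ≋ p ⊗ (q ⊗ r)
  ⊗-comm  : ∀ p q → p ⊗ q ≋ q ⊗ p
  ⊗-idˡ   : ∀ p → con 1ℚ ⊗ p ≋ p
  ⊗-zeroˡ : ∀ p → con 0ℚ ⊗ p ≋ con 0ℚ
  distribˡ : ∀ p q r → p ⊗ (q ⊕ r) ≋ (p ⊗ q) ⊕ (p ⊗ r)

  con-⊕   : ∀ x y → con (x ℚ.+ y) ≋ con x ⊕ con y
  con-⊗   : ∀ x y → con (x ℚ.* y) ≋ con x ⊗ con y

infix 8 ⊝_
⊝_ : ℚ[a] → ℚ[a]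
⊝ p = con (ℚ.- 1ℚ) ⊗ p

ℚ[a]-commutativeRing : CommutativeRing 0ℓ 0ℓ
ℚ[a]-commutativeRing = record
  { Carrier = ℚ[a] ; _≈_ = _≋_ ; _+_ = _⊕_ ; _*_ = _⊗_ ; -_ = ⊝_
  ; 0# = con 0ℚ ; 1# = con 1ℚ
  ; isCommutativeRing = record
    { isRing = record
      { +-isAbelianGroup = record
        { isGroup = record
          { isMonoid = record
            { isSemigroup = record
              { isMagma = record
                { isEquivalence = record
                  { refl = ≋-refl ; sym = ≋-sym ; trans = ≋-trans }
                ; ∙-cong = ⊕-cong }
              ; assoc = ⊕-assoc }
            ; identity = ⊕-idˡ , λ p → ≋-trans (⊕-comm p _) (⊕-idˡ p) }
          ; inverse = invˡ , λ p → ≋-trans (⊕-comm p _) (invˡ p)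
          ; ⁻¹-cong = ⊗-cong ≋-refl }
        ; comm = ⊕-comm }
      ; *-cong = ⊗-cong
      ; *-assoc = ⊗-assoc
      ; *-identity = ⊗-idˡ , λ p → ≋-trans (⊗-comm p _) (⊗-idˡ p)
      ; distrib = distribˡ , distribʳ }
    ; *-comm = ⊗-comm } }
  where
  distribʳ : ∀ p q r → (q ⊕ r) ⊗ p ≋ (q ⊗ p) ⊕ (r ⊗ p)
  distribʳ p q r =
    ≋-trans (⊗-comm _ p) (≋-trans (distribˡ p q r) (⊕-cong (⊗-comm p q) (⊗-comm p r)))

  invˡ : ∀ p → ⊝ p ⊕ p ≋ con 0ℚ
  invˡ p =
    ≋-trans (⊕-cong ≋-refl (≋-sym (⊗-idˡ p)))
    (≋-trans (≋-sym (distribʳ p _ _))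
    (≋-trans (⊗-cong (≋-sym (con-⊕ (ℚ.- 1ℚ) 1ℚ)) ≋-refl) (⊗-zeroˡ p)))

-- Evaluation at rational points respects _≋_, so _≋_ never identifies
-- expressions that are different as polynomial functions over ℚ.
⟦_⟧ : ℚ[a] → (ℕ → ℚ) → ℚ
⟦ con x ⟧ ρ = x
⟦ a k   ⟧ ρ = ρ k
⟦ p ⊕ q ⟧ ρ = ⟦ p ⟧ ρ ℚ.+ ⟦ q ⟧ ρ
⟦ p ⊗ q ⟧ ρ = ⟦ p ⟧ ρ ℚ.* ⟦ q ⟧ ρ

⟦⟧-cong : ∀ {p q} → p ≋ q → ∀ ρ → ⟦ p ⟧ ρ ≡ ⟦ q ⟧ ρ
⟦⟧-cong ≋-refl           ρ = refl
⟦⟧-cong (≋-sym e)        ρ = sym (⟦⟧-cong e ρ)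
⟦⟧-cong (≋-trans e f)    ρ = trans (⟦⟧-cong e ρ) (⟦⟧-cong f ρ)
⟦⟧-cong (⊕-cong e f)     ρ = cong₂ ℚ._+_ (⟦⟧-cong e ρ) (⟦⟧-cong f ρ)
⟦⟧-cong (⊗-cong e f)     ρ = cong₂ ℚ._*_ (⟦⟧-cong e ρ) (⟦⟧-cong f ρ)
⟦⟧-cong (⊕-assoc p q r)  ρ = ℚ.+-assoc (⟦ p ⟧ ρ) (⟦ q ⟧ ρ) (⟦ r ⟧ ρ)
⟦⟧-cong (⊕-comm p q)     ρ = ℚ.+-comm (⟦ p ⟧ ρ) (⟦ q ⟧ ρ)
⟦⟧-cong (⊕-idˡ p)        ρ = ℚ.+-identityˡ (⟦ p ⟧ ρ)
⟦⟧-cong (⊗-assoc p q r)  ρ = ℚ.*-assoc (⟦ p ⟧ ρ) (⟦ q ⟧ ρ) (⟦ r ⟧ ρ)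
⟦⟧-cong (⊗-comm p q)     ρ = ℚ.*-comm (⟦ p ⟧ ρ) (⟦ q ⟧ ρ)
⟦⟧-cong (⊗-idˡ p)        ρ = ℚ.*-identityˡ (⟦ p ⟧ ρ)
⟦⟧-cong (⊗-zeroˡ p)      ρ = ℚ.*-zeroˡ (⟦ p ⟧ ρ)
⟦⟧-cong (distribˡ p q r) ρ = ℚ.*-distribˡ-+ (⟦ p ⟧ ρ) (⟦ q ⟧ ρ) (⟦ r ⟧ ρ)
⟦⟧-cong (con-⊕ x y)      ρ = refl
⟦⟧-cong (con-⊗ x y)      ρ = refl

open RawSemiringDefs (CommutativeSemiring.rawSemiring (CommutativeRing.commutativeSemiring ℚ[a]-commutativeRing)) public
  using (_^_)

infixr 6 _·_ _•_

_•_ : ℚ → ℚ[a] → ℚ[a]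
c • p = con c ⊗ p

_·_ : ℕ → ℚ[a] → ℚ[a]
n · p = (+ n ℚ./ 1) • p

∑ ∏ : {I : Set} → List I → (I → ℚ[a]) → ℚ[a]
∑ is f = foldr (λ i p → f i ⊕ p) (con 0ℚ) is
∏ is f = foldr (λ i p → f i ⊗ p) (con 1ℚ) is

record FiniteSet : Set₁ where
  infix 4 _≟_
  field
    Carrier  : Set
    _≟_      : DecidableEquality Carrier
    points   : List Carrier
    complete : ∀ x → x ∈ₗ.∈ points
    unique   : Unique points

  Permutation : Set
  Permutation = Carrier ↔ Carrier

  infix 4 _≈_
  _≈_ : Permutation → Permutation → Set
  α ≈ β = ∀ x → Inverse.to α x ≡ Inverse.to β x

  _≈?_ : ∀ α β → Dec (α ≈ β)
  α ≈? β = map′ (λ all x → All.lookup all (complete x)) (λ eq → All.tabulate λ {x} _ → eq x)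
                (All.all? (λ x → Inverse.to α x ≟ Inverse.to β x) points)

  permutationDecSetoid : DecSetoid 0ℓ 0ℓ
  permutationDecSetoid = record
    { Carrier = Permutation ; _≈_ = _≈_
    ; isDecEquivalence = record
      { isEquivalence = record
        { refl = λ _ → refl ; sym = λ e x → sym (e x) ; trans = λ e f x → trans (e x) (f x) }
      ; _≟_ = _≈?_ } }

  permutationSetoid : Setoid 0ℓ 0ℓ
  permutationSetoid = DecSetoid.setoid permutationDecSetoid

  module _ (α : Permutation) where
    open Inverse α using (to)
    open DecMembership _≟_ using (_∈?_)

    -- The points y , α y , α² y , … up to, and excluding, the first that equals
    -- x.  The second argument is fuel bounding their number.
    until : Carrier → ℕ → Carrier → List Carrier
    until x zero    y = []
    until x (suc n) y = if does (y ≟ x) then [] else y ∷ until x n (to y)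

    -- The cycle (x  α x  α² x  …) through x.  No cycle has more than
    -- length points points, so the fuel does not run out.
    cycleThrough : Carrier → List Carrier
    cycleThrough x = x ∷ until x (length points) (to x)

    addCycle : Carrier → List (List Carrier) → List (List Carrier)
    addCycle x cs = if does (x ∈? concat cs) then cs else cycleThrough x ∷ cs

    -- The disjoint cycle decomposition of α, fixed points included.
    cycles : List (List Carrier)
    cycles = foldr addCycle [] points

    j : ℕ → ℕ
    j k = length (filter (λ c → length c ℕ.≟ k) cycles)

record PermutationGroup (X : FiniteSet) : Set where
  open FiniteSet X
  open SetoidMembership permutationSetoid public using () renaming (_∈_ to _∈ₚ_)
  field
    elements   : List Permutation
    distinct   : SetoidUnique.Unique permutationSetoid elements
    id-closed  : ↔-id Carrier ∈ₚ elements
    ∘-closed   : ∀ {α β} → α ∈ₚ elements → β ∈ₚ elements → (α ↔-∘ β) ∈ₚ elements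
    ⁻¹-closed  : ∀ {α} → α ∈ₚ elements → ↔-sym α ∈ₚ elements

  order : ℕ
  order = length elements

  instance
    order≢0 : NonZero order
    order≢0 with elements | id-closed
    ... | _ ∷ _ | _ = _

-- No cycle is longer than the number of points, so the product over k ≥ 1
-- may stop there.
Z : {X : FiniteSet} → PermutationGroup X → ℚ[a]
Z {X} A = (+ 1 ℚ./ order) • ∑ elements λ α → ∏ (upTo (length points)) λ k → a (suc k) ^ j α (suc k)
  where
  open FiniteSet X
  open PermutationGroup A

-- The p-element set {1, …, p} is represented by Fin p.
_-subsetsOf_ : ℕ → ℕ → Set
r -subsetsOf p = Σ (Subset p) λ s → ∣ s ∣ ≡ r

subset-≡ : ∀ {r p} {s t : r -subsetsOf p} → proj₁ s ≡ proj₁ t → s ≡ t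
subset-≡ {s = s , e} {.s , f} refl = cong (s ,_) (ℕ.≡-irrelevant e f)

with-0 : ∀ {r p} → r -subsetsOf p → suc r -subsetsOf suc p
with-0 (s , e) = inside ∷ s , cong suc e

without-0 : ∀ {r p} → r -subsetsOf p → r -subsetsOf suc p
without-0 (s , e) = outside ∷ s , e

allSubsets : ∀ r p → List (r -subsetsOf p)
allSubsets zero    zero    = ([] , refl) ∷ []
allSubsets (suc r) zero    = []
allSubsets zero    (suc p) = map without-0 (allSubsets zero p)
allSubsets (suc r) (suc p) = map with-0 (allSubsets r p) ++ map without-0 (allSubsets (suc r) p)

allSubsets-complete : ∀ {r p} (s : r -subsetsOf p) → s ∈ₗ.∈ allSubsets r p
allSubsets-complete {zero}  {zero}  ([] , refl) = here refl
allSubsets-complete {zero}  {suc p} (false ∷ s , e) = ∈-map⁺ without-0 (allSubsets-complete (s , e))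
allSubsets-complete {suc r} {suc p} (false ∷ s , e) =
  ∈-++⁺ʳ (map with-0 (allSubsets r p)) (∈-map⁺ without-0 (allSubsets-complete (s , e)))
allSubsets-complete {suc r} {suc p} (true ∷ s , e) =
  ∈-++⁺ˡ (subst (∈ₗ._∈ map with-0 (allSubsets r p)) (subset-≡ refl)
           (∈-map⁺ with-0 (allSubsets-complete (s , ℕ.suc-injective e))))

allSubsets-unique : ∀ r p → Unique (allSubsets r p)
allSubsets-unique zero    zero    = All.[] ∷ []
allSubsets-unique (suc r) zero    = []
allSubsets-unique zero    (suc p) = Uniqueₚ.map⁺ (λ eq → subset-≡ (Vec.∷-injectiveʳ (cong proj₁ eq))) (allSubsets-unique zero p)
allSubsets-unique (suc r) (suc p) =
  Uniqueₚ.++⁺ (Uniqueₚ.map⁺ (λ eq → subset-≡ (Vec.∷-injectiveʳ (cong proj₁ eq))) (allSubsets-unique r p))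
              (Uniqueₚ.map⁺ (λ eq → subset-≡ (Vec.∷-injectiveʳ (cong proj₁ eq))) (allSubsets-unique (suc r) p))
              λ (m , n) → disjoint (∈-map⁻ with-0 m) (∈-map⁻ without-0 n)
  where
  disjoint : ∀ {s} → ∃ (λ t → t ∈ₗ.∈ allSubsets r p × s ≡ with-0 t) →
             ∃ (λ t → t ∈ₗ.∈ allSubsets (suc r) p × s ≡ without-0 t) → ⊥
  disjoint (_ , _ , refl) (_ , _ , ())

Subsets : ℕ → ℕ → FiniteSet
Subsets r p = record
  { Carrier  = r -subsetsOf p
  ; _≟_      = λ s t → map′ subset-≡ (cong proj₁) (Vec.≡-dec Bool._≟_ (proj₁ s) (proj₁ t))
  ; points   = allSubsets r p
  ; complete = allSubsets-complete
  ; unique   = allSubsets-unique r p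
  }

-- The set α s, written through α⁻¹; see ∈-image.
image : ∀ {p} → Permutation′ p → Subset p → Subset p
image α s = tabulate λ i → lookup s (α ⟨$⟩ˡ i)

∈-image : ∀ {p} (α : Permutation′ p) (s : Subset p) {i} →
          i ∈ image α s ⇔ ∃ λ h → h ∈ s × α ⟨$⟩ʳ h ≡ i
∈-image α s {i} = mk⇔
  (λ i∈ → α ⟨$⟩ˡ i , Vec.lookup⇒[]= _ s (trans (sym (Vec.lookup∘tabulate _ i)) (Vec.[]=⇒lookup i∈)) , Perm.inverseʳ α)
  (λ { (h , h∈s , refl) → Vec.lookup⇒[]= i _
         (trans (Vec.lookup∘tabulate _ i) (trans (cong (lookup s) (Perm.inverseˡ α)) (Vec.[]=⇒lookup h∈s))) })

module _ where
  open CommutativeMonoidSum ℕ.+-0-commutativeMonoid using (sum; sum-permute; sum-cong-≗)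

  indicator : Bool → ℕ
  indicator b = if b then 1 else 0

  ∣tabulate∣ : ∀ {p} (f : Fin p → Bool) → ∣ tabulate f ∣ ≡ sum (indicator ∘ f)
  ∣tabulate∣ {zero}  f = refl
  ∣tabulate∣ {suc p} f with f zero
  ... | true  = cong suc (∣tabulate∣ (f ∘ suc))
  ... | false = ∣tabulate∣ (f ∘ suc)

  ∣image∣ : ∀ {p} (α : Permutation′ p) s → ∣ image α s ∣ ≡ ∣ s ∣
  ∣image∣ α s = begin
    ∣ image α s ∣                              ≡⟨ ∣tabulate∣ (λ i → lookup s (α ⟨$⟩ˡ i)) ⟩
    sum (λ i → indicator (lookup s (α ⟨$⟩ˡ i))) ≡⟨ sum-permute (indicator ∘ lookup s) (Perm.flip α) ⟨
    sum (indicator ∘ lookup s)                 ≡⟨ ∣tabulate∣ (lookup s) ⟨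
    ∣ tabulate (lookup s) ∣                    ≡⟨ cong ∣_∣ (Vec.tabulate∘lookup s) ⟩
    ∣ s ∣                                      ∎
    where open ≡-Reasoning

image-inverse : ∀ {p} (α β : Permutation′ p) → (∀ i → α ⟨$⟩ˡ (β ⟨$⟩ˡ i) ≡ i) →
                ∀ s → image β (image α s) ≡ s
image-inverse α β inv s = trans
  (Vec.tabulate-cong λ i → trans (Vec.lookup∘tabulate _ (β ⟨$⟩ˡ i)) (cong (lookup s) (inv i)))
  (Vec.tabulate∘lookup s)

induced : ∀ r {p} → Permutation′ p → FiniteSet.Permutation (Subsets r p)
induced r {p} α = mk↔ₛ′ (act α) (act (Perm.flip α))
  (λ (s , _) → subset-≡ (image-inverse (Perm.flip α) α (λ _ → Perm.inverseʳ α) s))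
  (λ (s , _) → subset-≡ (image-inverse α (Perm.flip α) (λ _ → Perm.inverseˡ α) s))
  where
  act : Permutation′ p → r -subsetsOf p → r -subsetsOf p
  act β (s , e) = image β s , trans (∣image∣ β s) e

S : ∀ p → List (Permutation′ p)
S zero    = Perm.id ∷ []
S (suc p) = cartesianProductWith (Perm.insert zero) (allFin (suc p)) (S p)

insert-cong : ∀ {p} i {α β : Permutation′ p} → α Perm.≈ β →
              Perm.insert zero i α Perm.≈ Perm.insert zero i β
insert-cong i {α} {β} α≈β zero    = refl
insert-cong i {α} {β} α≈β (suc k) = trans (Perm.insert-punchIn zero i α k)
  (trans (cong (punchIn i) (α≈β k)) (sym (Perm.insert-punchIn zero i β k)))

S-complete : ∀ {p} (α : Permutation′ p) → Any (α Perm.≈_) (S p)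
S-complete {zero}  α = here λ ()
S-complete {suc p} α = Anyₚ.cartesianProductWith⁺ (Perm.insert zero)
  (λ { {i} {β} refl α≈β k → trans (sym (Perm.insert-remove zero α k))
         (insert-cong (α ⟨$⟩ʳ zero) {Perm.remove zero α} {β} α≈β k) })
  (∈-allFin (α ⟨$⟩ʳ zero)) (S-complete (Perm.remove zero α))

module _ (r p : ℕ) where
  open FiniteSet (Subsets r p)
  open SetoidMembership permutationSetoid using () renaming (_∈_ to _∈ₚ_)
  open DecSetoid permutationDecSetoid using () renaming (trans to ≈-trans; sym to ≈-sym)

  -- Distinct α may induce the same permutation (for instance when r = p), hence
  -- the deduplication.
  inducedPermutations : List Permutation
  inducedPermutations = deduplicate _≈?_ (map (induced r) (S p))

  induced-cong : ∀ {α β : Permutation′ p} → α Perm.≈ β → induced r α ≈ induced r β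
  induced-cong {α} {β} α≈β (s , _) = subset-≡ (Vec.tabulate-cong λ i → cong (lookup s)
    (trans (cong (α ⟨$⟩ˡ_) (sym (Perm.inverseʳ β)))
      (trans (cong (α ⟨$⟩ˡ_) (sym (α≈β (β ⟨$⟩ˡ i)))) (Perm.inverseˡ α))))

  ∈-inducedPermutations : ∀ γ → γ ∈ₚ inducedPermutations ⇔ ∃ λ α → γ ≈ induced r α
  ∈-inducedPermutations γ = mk⇔
    (λ γ∈ → Any.satisfied (Anyₚ.map⁻ (SetoidMembershipₚ.∈-deduplicate⁻ permutationSetoid _≈?_ (map (induced r) (S p)) {γ} γ∈)))
    (λ (α , γ≈α′) → SetoidMembershipₚ.∈-deduplicate⁺ permutationSetoid _≈?_
      (λ {x} {y} {z} z≈y x≈y → ≈-trans {x} {y} {z} x≈y (≈-sym {z} {y} z≈y))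
      {map (induced r) (S p)} {γ}
      (Anyₚ.map⁺ (Any.map (λ {β} α≈β → ≈-trans {γ} {induced r α} {induced r β} γ≈α′ (induced-cong {α} {β} α≈β))
                          (S-complete α))))

  private
    from-cong : ∀ {γ δ : Permutation} → γ ≈ δ → ∀ x → Inverse.from γ x ≡ Inverse.from δ x
    from-cong {γ} {δ} γ≈δ x = trans
      (cong (Inverse.from γ) (trans (sym (Inverse.strictlyInverseˡ δ x)) (sym (γ≈δ (Inverse.from δ x)))))
      (Inverse.strictlyInverseʳ γ (Inverse.from δ x))

    image-∘ : ∀ (α β : Permutation′ p) s → image α (image β s) ≡ image (β Perm.∘ₚ α) s
    image-∘ α β s = Vec.tabulate-cong λ i → Vec.lookup∘tabulate _ (α ⟨$⟩ˡ i)

  _-groupOfS_ : PermutationGroup (Subsets r p)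
  _-groupOfS_ = record
    { elements  = inducedPermutations
    ; distinct  = DecUniqueₚ.deduplicate-! permutationDecSetoid (map (induced r) (S p))
    ; id-closed = Equivalence.from (∈-inducedPermutations (↔-id _))
        (Perm.id , λ (s , _) → subset-≡ (sym (Vec.tabulate∘lookup s)))
    ; ∘-closed  = λ {γ} {δ} γ∈ δ∈ →
        let α , γ≈α′ = Equivalence.to (∈-inducedPermutations γ) γ∈
            β , δ≈β′ = Equivalence.to (∈-inducedPermutations δ) δ∈
        in Equivalence.from (∈-inducedPermutations (γ ↔-∘ δ))
             (β Perm.∘ₚ α , λ x → trans (cong (Inverse.to γ) (δ≈β′ x))
               (trans (γ≈α′ (Inverse.to (induced r β) x)) (subset-≡ (image-∘ α β (proj₁ x)))))
    ; ⁻¹-closed = λ {γ} γ∈ →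
        let α , γ≈α′ = Equivalence.to (∈-inducedPermutations γ) γ∈
        in Equivalence.from (∈-inducedPermutations (↔-sym γ))
             (Perm.flip α , from-cong {γ} {induced r α} γ≈α′)
    }

{-# OPTIONS --safe #-}
module Submission where

-- S₇ acts faithfully on the 3-subsets, because these separate points, so the sum
-- defining the cycle index may be taken over S₇ itself.  Numbering subsets by their
-- binary codes turns every induced permutation into a function on ℕ whose cycle
-- lengths can be computed quickly; the 5040 cycle types are then tallied by
-- evaluation.

open import Defs
open import Data.Integer.Base using (+_)
open import Data.Nat.Base using (_!)
open import Data.Rational.Base using (_/_)

open import Algebra.Bundles using (CommutativeRing; Monoid)
import Algebra.Properties.CommutativeMonoid.Sum as CommutativeMonoidSum
import Algebra.Properties.CommutativeSemigroup as CommutativeSemigroupProperties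
import Algebra.Properties.Semiring.Sum as SemiringSum
open import Data.Bool.Base using (Bool; true; false; if_then_else_; _∨_)
import Data.Bool.Properties as Bool
open import Data.Fin.Base using (Fin; zero; suc; toℕ)
import Data.Fin.Properties as Fin
open import Data.Fin.Permutation as Perm using (Permutation′; _⟨$⟩ʳ_; _⟨$⟩ˡ_)
open import Data.Fin.Subset using (Subset)
import Data.Integer.Base as ℤ
import Data.Integer.Properties as ℤ
open import Data.List.Base using (List; []; _∷_; _++_; map; foldr; foldl; concat; length; filter; deduplicate)
open import Data.List.Base using (upTo; applyUpTo; replicate; tabulate)
import Data.List.Membership.DecPropositional as DecMembership
import Data.List.Properties as List
open import Data.List.Relation.Unary.All as All using ()
open import Data.List.Relation.Unary.AllPairs using (AllPairs; []; _∷_)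
open import Data.List.Relation.Unary.Any using (Any; any?; satisfied)
import Data.List.Relation.Unary.Unique.Propositional.Properties as Unique
open import Data.List.Relation.Unary.Unique.Setoid using (Unique)
import Data.List.Relation.Unary.Unique.Setoid.Properties as SetoidUnique
open import Data.Nat.Base as ℕ using (ℕ; zero; suc; NonZero; _≡ᵇ_)
open import Data.Nat.Divisibility using (divides-refl)
import Data.Nat.DivMod as ℕ
import Data.Nat.Properties as ℕ
open import Data.Product.Base using (_×_; _,_; proj₁; proj₂; map₂)
import Data.Product.Properties as Product
open import Data.Rational.Base as ℚ using (0ℚ; 1ℚ; toℚᵘ)
import Data.Rational.Properties as ℚ
import Data.Rational.Unnormalised.Base as ℚᵘ
import Data.Rational.Unnormalised.Properties as ℚᵘ
import Data.Vec.Base as Vec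
import Data.Vec.Properties as Vec
open import Function.Base using (_∘_; id)
open import Function.Bundles using (Inverse; mk⇔)
open import Level using (0ℓ)
open import Relation.Binary.Bundles using (Setoid)
open import Relation.Binary.Core using (Rel)
open import Relation.Binary.Definitions using (Decidable; DecidableEquality)
open import Relation.Binary.PropositionalEquality
import Relation.Binary.Reasoning.Setoid as SetoidReasoning
open import Relation.Nullary.Decidable using (Dec; yes; no; does; does-⇔; toWitness; decidable-stable)
open import Relation.Nullary.Decidable using (¬?; _×-dec_; _→-dec_)
open import Relation.Nullary.Negation using (¬_; contradiction)

-- Faithfulness of the action on subsets

deduplicate-! : ∀ {A : Set} {R : Rel A 0ℓ} (R? : Decidable R) {xs} →
                AllPairs (λ x y → ¬ R x y) xs → deduplicate R? xs ≡ xs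
deduplicate-! R? []                  = refl
deduplicate-! R? (_∷_ {x} x∉xs xs!) = cong (x ∷_)
  (trans (cong (filter (¬? ∘ R? x)) (deduplicate-! R? xs!)) (List.filter-all (¬? ∘ R? x) x∉xs))

≈-setoid : ℕ → Setoid 0ℓ 0ℓ
≈-setoid p = record
  { Carrier = Permutation′ p ; _≈_ = Perm._≈_
  ; isEquivalence = record
    { refl = λ _ → refl ; sym = λ e i → sym (e i) ; trans = λ e f i → trans (e i) (f i) } }

-- The inserted permutation sends `zero` to `i` and `suc k` to `punchIn i` of the image of `k` under
-- `α`, so `i` is read off at `zero` and `α` by cancelling `punchIn i`.
insert-injective : ∀ {p} {i j} {α β : Permutation′ p} →
                   Perm.insert zero i α Perm.≈ Perm.insert zero j β → i ≡ j × α Perm.≈ β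
insert-injective {i = i} {j} {α} {β} e with refl ← e zero = refl , λ k →
  Fin.punchIn-injective i _ _ (trans (sym (Perm.insert-punchIn zero i α k))
    (trans (e (suc k)) (Perm.insert-punchIn zero i β k)))

S-unique : ∀ p → Unique (≈-setoid p) (S p)
S-unique zero    = All.[] ∷ []
S-unique (suc p) = SetoidUnique.cartesianProductWith⁺
  (setoid (Fin (suc p))) (≈-setoid p) (≈-setoid (suc p)) (Perm.insert zero)
  (λ {i} {j} {α} {β} → insert-injective {α = α} {β}) (Unique.allFin⁺ (suc p)) (S-unique p)

χ : ∀ {r p} → r -subsetsOf p → Fin p → Bool
χ (s , _) = Vec.lookup s

-- The witness is sought in the finite list `allSubsets`, so that the condition can be decided by
-- search for concrete `r` and `p`.
Separated : ∀ r p → Fin p → Fin p → Set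
Separated r p i h = Any (λ s → χ s i ≡ true × χ s h ≡ false) (allSubsets r p)

separated? : ∀ r p i h → Dec (Separated r p i h)
separated? r p i h = any? (λ s → (χ s i Bool.≟ true) ×-dec (χ s h Bool.≟ false)) (allSubsets r p)

module _ {r p} (separated : ∀ i h → i ≢ h → Separated r p i h) where

  -- A point k lies in the image of s under α exactly when α⁻¹ k lies in s. If α⁻¹ k and β⁻¹ k
  -- differed, an s containing only the first would have different images under α and β. Equal
  -- inverses then give equal permutations.
  induced-injective : ∀ {α β : Permutation′ p} →
                      FiniteSet._≈_ (Subsets r p) (induced r α) (induced r β) → α Perm.≈ β
  induced-injective {α} {β} e i = begin
    α ⟨$⟩ʳ i                     ≡⟨ Perm.inverseʳ β ⟨
    β ⟨$⟩ʳ (β ⟨$⟩ˡ (α ⟨$⟩ʳ i))  ≡⟨ cong (β ⟨$⟩ʳ_) (inverses-agree (α ⟨$⟩ʳ i)) ⟨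
    β ⟨$⟩ʳ (α ⟨$⟩ˡ (α ⟨$⟩ʳ i))  ≡⟨ cong (β ⟨$⟩ʳ_) (Perm.inverseˡ α) ⟩
    β ⟨$⟩ʳ i                     ∎
    where
    open ≡-Reasoning

    χ-agree : ∀ (s : r -subsetsOf p) k → χ s (α ⟨$⟩ˡ k) ≡ χ s (β ⟨$⟩ˡ k)
    χ-agree s k = trans (sym (Vec.lookup∘tabulate _ k))
      (trans (cong (λ t → χ t k) (e s)) (Vec.lookup∘tabulate _ k))

    inverses-agree : ∀ k → α ⟨$⟩ˡ k ≡ β ⟨$⟩ˡ k
    inverses-agree k = decidable-stable (α ⟨$⟩ˡ k Fin.≟ β ⟨$⟩ˡ k) λ differ →
      let s , in-s , out-s = satisfied (separated _ _ differ)
      in contradiction (trans (sym in-s) (trans (χ-agree s k) out-s)) λ ()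

  -- By faithfulness, inducing creates no repetitions among the distinct entries of `S p`, so every
  -- pass of the deduplication removes nothing.
  inducedPermutations≡ : inducedPermutations r p ≡ map (induced r) (S p)
  inducedPermutations≡ = deduplicate-! (FiniteSet._≈?_ (Subsets r p))
    (SetoidUnique.map⁺ (≈-setoid p) (FiniteSet.permutationSetoid (Subsets r p))
      (λ {α} {β} → induced-injective {α} {β}) (S-unique p))

-- Integer codes of subsets

-- The lowest binary digit comes first, so remainder and quotient by 2 recover head and tail; this
-- yields injectivity.
code : ∀ {p} → Subset p → ℕ
code Vec.[]       = 0
code (b Vec.∷ s) = indicator b ℕ.+ code s ℕ.* 2

code-% : ∀ b n → (indicator b ℕ.+ n ℕ.* 2) ℕ.% 2 ≡ indicator b
code-% false n = ℕ.m*n%n≡0 n 2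
code-% true  n = ℕ.[m+kn]%n≡m%n 1 n 2

code-/ : ∀ b n → (indicator b ℕ.+ n ℕ.* 2) ℕ./ 2 ≡ n
code-/ false n = ℕ.m*n/n≡m n 2
code-/ true  n = trans (ℕ.+-distrib-/-∣ʳ 1 {n ℕ.* 2} {2} (divides-refl n)) (ℕ.m*n/n≡m n 2)

indicator-injective : ∀ {b c} → indicator b ≡ indicator c → b ≡ c
indicator-injective {false} {false} _ = refl
indicator-injective {true}  {true}  _ = refl

code-injective : ∀ {p} {s t : Subset p} → code s ≡ code t → s ≡ t
code-injective {s = Vec.[]}    {Vec.[]}    _ = refl
code-injective {s = b Vec.∷ s} {c Vec.∷ t} e = cong₂ Vec._∷_
  (indicator-injective (trans (sym (code-% b (code s))) (trans (cong (ℕ._% 2) e) (code-% c (code t)))))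
  (code-injective (trans (sym (code-/ b (code s))) (trans (cong (ℕ._/ 2) e) (code-/ c (code t)))))

-- The i-th binary digit of n is given the weight wsᵢ in place of 2 ^ i.
reweigh : List ℕ → ℕ → ℕ
reweigh []       n = 0
reweigh (w ∷ ws) n = n ℕ.% 2 ℕ.* w ℕ.+ reweigh ws (n ℕ./ 2)

weights : ∀ {p} → Permutation′ p → List ℕ
weights α = tabulate λ i → 2 ℕ.^ toℕ (α ⟨$⟩ʳ i)

module _ where
  open CommutativeMonoidSum ℕ.+-0-commutativeMonoid using (sum; sum-permute; sum-cong-≗)
  open SemiringSum ℕ.+-*-semiring using (*-distribʳ-sum)
  open ≡-Reasoning

  bit : ∀ {p} → Subset p → Fin p → ℕ
  bit s i = indicator (Vec.lookup s i)

  reweigh-code : ∀ {p} (w : Fin p → ℕ) (s : Subset p) →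
                 reweigh (tabulate w) (code s) ≡ sum (λ i → bit s i ℕ.* w i)
  reweigh-code w Vec.[]       = refl
  reweigh-code w (b Vec.∷ s) = cong₂ ℕ._+_ (cong (ℕ._* w zero) (code-% b (code s)))
    (trans (cong (reweigh (tabulate (w ∘ suc))) (code-/ b (code s))) (reweigh-code (w ∘ suc) s))

  code-sum : ∀ {p} (s : Subset p) → code s ≡ sum (λ i → bit s i ℕ.* 2 ℕ.^ toℕ i)
  code-sum Vec.[]       = refl
  code-sum (b Vec.∷ s) = cong₂ ℕ._+_ (sym (ℕ.*-identityʳ (indicator b))) (begin
    code s ℕ.* 2
      ≡⟨ cong (ℕ._* 2) (code-sum s) ⟩
    sum (λ i → bit s i ℕ.* 2 ℕ.^ toℕ i) ℕ.* 2
      ≡⟨ *-distribʳ-sum 2 (λ i → bit s i ℕ.* 2 ℕ.^ toℕ i) ⟩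
    sum (λ i → bit s i ℕ.* 2 ℕ.^ toℕ i ℕ.* 2)
      ≡⟨ sum-cong-≗ (λ i → trans (ℕ.*-assoc (bit s i) _ 2) (cong (bit s i ℕ.*_) (ℕ.*-comm (2 ℕ.^ toℕ i) 2))) ⟩
    sum (λ i → bit s i ℕ.* 2 ℕ.^ suc (toℕ i)) ∎)

  bit-image : ∀ {p} (α : Permutation′ p) s i → bit (image α s) i ≡ bit s (α ⟨$⟩ˡ i)
  bit-image α s i = cong indicator (Vec.lookup∘tabulate (λ k → Vec.lookup s (α ⟨$⟩ˡ k)) i)

  -- Digit i of the image is digit α⁻¹ i of s. Reindexing the sum along α moves the permutation from
  -- the digits to the weights: digit h of s now counts 2 to the power α h.
  code-image : ∀ {p} (α : Permutation′ p) s → code (image α s) ≡ reweigh (weights α) (code s)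
  code-image α s = begin
    code (image α s)
      ≡⟨ code-sum (image α s) ⟩
    sum (λ i → bit (image α s) i ℕ.* 2 ℕ.^ toℕ i)
      ≡⟨ sum-cong-≗ (λ i → cong (ℕ._* 2 ℕ.^ toℕ i) (bit-image α s i)) ⟩
    sum (λ i → bit s (α ⟨$⟩ˡ i) ℕ.* 2 ℕ.^ toℕ i)
      ≡⟨ sum-permute (λ i → bit s (α ⟨$⟩ˡ i) ℕ.* 2 ℕ.^ toℕ i) α ⟩
    sum (λ h → bit s (α ⟨$⟩ˡ (α ⟨$⟩ʳ h)) ℕ.* 2 ℕ.^ toℕ (α ⟨$⟩ʳ h))
      ≡⟨ sum-cong-≗ (λ h → cong (λ i → bit s i ℕ.* 2 ℕ.^ toℕ (α ⟨$⟩ʳ h)) (Perm.inverseˡ α)) ⟩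
    sum (λ h → bit s h ℕ.* 2 ℕ.^ toℕ (α ⟨$⟩ʳ h))
      ≡⟨ reweigh-code (λ h → 2 ℕ.^ toℕ (α ⟨$⟩ʳ h)) s ⟨
    reweigh (weights α) (code s) ∎

-- Cycle decompositions on codes

elemℕ : ℕ → List ℕ → Bool
elemℕ x []       = false
elemℕ x (y ∷ ys) = (x ≡ᵇ y) ∨ elemℕ x ys

-- A copy, step by step, of the decomposition in `FiniteSet`, with Boolean tests on numbers and a
-- plain function in place of a bijection, so that it evaluates fast.
module _ (σ : ℕ → ℕ) where
  untilℕ : ℕ → ℕ → ℕ → List ℕ
  untilℕ x zero    y = []
  untilℕ x (suc n) y = if y ≡ᵇ x then [] else y ∷ untilℕ x n (σ y)

  addCycleℕ : ℕ → ℕ → List (List ℕ) → List (List ℕ)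
  addCycleℕ fuel x cs = if elemℕ x (concat cs) then cs else (x ∷ untilℕ x fuel (σ x)) ∷ cs

  cyclesℕ : List ℕ → List (List ℕ)
  cyclesℕ xs = foldr (addCycleℕ (length xs)) [] xs

module _ {X : FiniteSet} where
  open FiniteSet X

  module _ {f : Carrier → ℕ} (f-injective : ∀ {x y} → f x ≡ f y → x ≡ y)
           {π : Permutation} {σ : ℕ → ℕ} (equivariant : ∀ x → f (Inverse.to π x) ≡ σ (f x)) where
    open Inverse π using (to)
    open DecMembership _≟_ using (_∈?_)

    -- All branching in the decomposition rests on equality of points, and an injective `f`
    -- preserves the outcome of these tests.
    ≟-map : ∀ x y → does (x ≟ y) ≡ (f x ≡ᵇ f y)
    ≟-map x y = does-⇔ (mk⇔ (cong f) f-injective) (x ≟ y) (f x ℕ.≟ f y)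

    ∈?-map : ∀ x ys → does (x ∈? ys) ≡ elemℕ (f x) (map f ys)
    ∈?-map x []       = refl
    ∈?-map x (y ∷ ys) = cong₂ _∨_ (≟-map x y) (∈?-map x ys)

    until-map : ∀ x n y → map f (until π x n y) ≡ untilℕ σ (f x) n (f y)
    until-map x zero    y = refl
    -- Abstracting both tests together with their equality forces the same branch on both sides.
    until-map x (suc n) y with does (y ≟ x) | f y ≡ᵇ f x | ≟-map y x
    ... | true  | .true  | refl = refl
    ... | false | .false | refl = cong (f y ∷_)
      (trans (until-map x n (to y)) (cong (untilℕ σ (f x) n) (equivariant y)))

    addCycle-map : ∀ x cs → map (map f) (addCycle π x cs) ≡
                   addCycleℕ σ (length points) (f x) (map (map f) cs)
    addCycle-map x cs
      with does (x ∈? concat cs) | elemℕ (f x) (concat (map (map f) cs))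
         | trans (∈?-map x (concat cs)) (cong (elemℕ (f x)) (sym (List.concat-map cs)))
    ... | true  | .true  | refl = refl
    ... | false | .false | refl = cong (λ c → (f x ∷ c) ∷ map (map f) cs)
      (trans (until-map x (length points) (to x)) (cong (untilℕ σ (f x) (length points)) (equivariant x)))

    cycles-map : map (map f) (cycles π) ≡ cyclesℕ σ (map f points)
    -- Both sides get the same fuel, as the list of codes is as long as `points`; `go` keeps it
    -- fixed while the list shrinks.
    cycles-map rewrite List.length-map f points = go points
      where
      go : ∀ xs → map (map f) (foldr (addCycle π) [] xs) ≡
                     foldr (addCycleℕ σ (length points)) [] (map f xs)
      go []       = refl
      go (x ∷ xs) = trans (addCycle-map x (foldr (addCycle π) [] xs))
        (cong (addCycleℕ σ (length points) (f x)) (go xs))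

    cycleLengths-map : map length (cycles π) ≡ map length (cyclesℕ σ (map f points))
    cycleLengths-map = begin
      map length (cycles π)               ≡⟨ List.map-cong (List.length-map f) (cycles π) ⟨
      map (length ∘ map f) (cycles π)     ≡⟨ List.map-∘ (cycles π) ⟩
      map length (map (map f) (cycles π)) ≡⟨ cong (map length) cycles-map ⟩
      map length (cyclesℕ σ (map f points)) ∎
      where open ≡-Reasoning

cycleLengths : ∀ {p} → List ℕ → Permutation′ p → List ℕ
cycleLengths codes α = map length (cyclesℕ (reweigh (weights α)) codes)

codes : ∀ r p → List ℕ
codes r p = map (code ∘ proj₁) (allSubsets r p)

cycleLengths-induced : ∀ r {p} (α : Permutation′ p) →
                       map length (FiniteSet.cycles (Subsets r p) (induced r α)) ≡
                       cycleLengths (codes r p) α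
cycleLengths-induced r {p} α = cycleLengths-map {Subsets r p} (λ e → subset-≡ (code-injective e))
  {induced r α} (λ s → code-image α (proj₁ s))

-- Monomials

count : ℕ → List ℕ → ℕ
count k []       = 0
count k (l ∷ ls) = if l ≡ᵇ k then suc (count k ls) else count k ls

j≡count : ∀ (X : FiniteSet) α k → FiniteSet.j X α k ≡ count k (map length (FiniteSet.cycles X α))
j≡count X α k = go (FiniteSet.cycles X α)
  where
  go : ∀ cs → length (filter (λ c → length c ℕ.≟ k) cs) ≡ count k (map length cs)
  go []       = refl
  go (c ∷ cs) with length c ≡ᵇ k
  ... | true  = cong suc (go cs)
  ... | false = go cs

incrementAt : ℕ → List ℕ → List ℕ
incrementAt _       []       = []
incrementAt zero    (e ∷ es) = suc e ∷ es
incrementAt (suc l) (e ∷ es) = e ∷ incrementAt l es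

incrementAt-applyUpTo : ∀ l (e : ℕ → ℕ) n →
  incrementAt l (applyUpTo e n) ≡ applyUpTo (λ k → if l ≡ᵇ k then suc (e k) else e k) n
incrementAt-applyUpTo l       e zero    = refl
incrementAt-applyUpTo zero    e (suc n) = refl
incrementAt-applyUpTo (suc l) e (suc n) = cong (e 0 ∷_) (incrementAt-applyUpTo l (e ∘ suc) n)

-- The exponent vector, built in one pass over the cycle lengths. Position `l` belongs to the
-- variable `a (suc l)`, hence the shift by one.
multiplicities : ℕ → List ℕ → List ℕ
multiplicities n []           = applyUpTo (λ _ → 0) n
multiplicities n (zero  ∷ ls) = multiplicities n ls
multiplicities n (suc l ∷ ls) = incrementAt l (multiplicities n ls)

multiplicities-count : ∀ n ls → multiplicities n ls ≡ applyUpTo (λ k → count (suc k) ls) n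
multiplicities-count n []           = refl
multiplicities-count n (zero  ∷ ls) = multiplicities-count n ls
multiplicities-count n (suc l ∷ ls) = trans (cong (incrementAt l) (multiplicities-count n ls))
  (incrementAt-applyUpTo l (λ k → count (suc k) ls) n)

-- Parametrised by g because applyUpTo recurses on g ∘ suc.
monomial : (ℕ → ℕ) → List ℕ → ℚ[a]
monomial g []       = con 1ℚ
monomial g (e ∷ es) = a (suc (g 0)) ^ e ⊗ monomial (g ∘ suc) es

∏-applyUpTo : ∀ (e g : ℕ → ℕ) n →
              ∏ (applyUpTo g n) (λ k → a (suc k) ^ e k) ≡ monomial g (applyUpTo (e ∘ g) n)
∏-applyUpTo e g zero    = refl
∏-applyUpTo e g (suc n) = cong (a (suc (g 0)) ^ e (g 0) ⊗_) (∏-applyUpTo e (g ∘ suc) n)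

∏-cong : ∀ {I : Set} (is : List I) {f g : I → ℚ[a]} → (∀ i → f i ≡ g i) → ∏ is f ≡ ∏ is g
∏-cong is f≗g = List.foldr-cong (λ i p → cong (_⊗ p) (f≗g i)) refl is

cycleMonomial : (X : FiniteSet) → FiniteSet.Permutation X → ℚ[a]
cycleMonomial X α = ∏ (upTo (length (FiniteSet.points X))) λ k → a (suc k) ^ FiniteSet.j X α (suc k)

-- The monomial depends on the permutation only through its exponent vector, a datum with decidable
-- equality by which terms can be collected.
cycleMonomial≡ : ∀ X α → cycleMonomial X α ≡
                 monomial id (multiplicities (length (FiniteSet.points X)) (map length (FiniteSet.cycles X α)))
cycleMonomial≡ X α = trans
  (∏-cong (upTo n) (λ k → cong (a (suc k) ^_) (j≡count X α (suc k))))
  (trans (∏-applyUpTo (λ k → count (suc k) ls) id n)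
         (cong (monomial id) (sym (multiplicities-count n ls))))
  where
  n  = length (FiniteSet.points X)
  ls = map length (FiniteSet.cycles X α)

-- Collecting equal terms

-- For a variable `n`, the normalisation by a gcd in `+ n / 1` does not reduce; hence the detour
-- through unnormalised rationals.
1+n/1 : ∀ n → + suc n / 1 ≡ 1ℚ ℚ.+ (+ n / 1)
1+n/1 n = ℚ.toℚᵘ-injective (begin
  toℚᵘ (+ suc n / 1)
    ≈⟨ ℚ.toℚᵘ-fromℚᵘ (ℚᵘ.mkℚᵘ (+ suc n) 0) ⟩
  ℚᵘ.mkℚᵘ (+ suc n) 0
    ≈⟨ ℚᵘ.*≡* (cong (λ m → (+ 1 ℤ.+ m) ℤ.* + 1) (sym (ℤ.*-identityʳ (+ n)))) ⟩
  ℚᵘ.1ℚᵘ ℚᵘ.+ ℚᵘ.mkℚᵘ (+ n) 0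
    ≈⟨ ℚᵘ.+-cong (ℚᵘ.≃-refl {ℚᵘ.1ℚᵘ}) (ℚ.toℚᵘ-fromℚᵘ (ℚᵘ.mkℚᵘ (+ n) 0)) ⟨
  toℚᵘ 1ℚ ℚᵘ.+ toℚᵘ (+ n / 1)
    ≈⟨ ℚ.toℚᵘ-homo-+ 1ℚ (+ n / 1) ⟨
  toℚᵘ (1ℚ ℚ.+ (+ n / 1)) ∎)
  where open SetoidReasoning ℚᵘ.≃-setoid

module Ring = CommutativeRing ℚ[a]-commutativeRing
open SetoidReasoning Ring.setoid

suc·-≋ : ∀ n p → suc n · p ≋ p ⊕ n · p
suc·-≋ n p = begin
  con (+ suc n / 1) ⊗ p           ≡⟨ cong (λ c → con c ⊗ p) (1+n/1 n) ⟩
  con (1ℚ ℚ.+ (+ n / 1)) ⊗ p      ≈⟨ ⊗-cong (con-⊕ 1ℚ (+ n / 1)) ≋-refl ⟩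
  (con 1ℚ ⊕ con (+ n / 1)) ⊗ p    ≈⟨ Ring.distribʳ p (con 1ℚ) (con (+ n / 1)) ⟩
  con 1ℚ ⊗ p ⊕ n · p              ≈⟨ ⊕-cong (⊗-idˡ p) ≋-refl ⟩
  p ⊕ n · p                       ∎

-- The closed fraction `+ 1 / 1` evaluates to `1ℚ`.
1·-≋ : ∀ p → 1 · p ≋ p
1·-≋ = ⊗-idˡ

module _ {A : Set} (_≟_ : DecidableEquality A) where
  bump : A → List (ℕ × A) → List (ℕ × A)
  bump x []            = (1 , x) ∷ []
  bump x ((n , y) ∷ t) = if does (x ≟ y) then (suc n , y) ∷ t else (n , y) ∷ bump x t

  module _ (f : A → ℚ[a]) where
    weighted : ℕ × A → ℚ[a]
    weighted (n , x) = n · f x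

    ∑-bump : ∀ x t → ∑ (bump x t) weighted ≋ f x ⊕ ∑ t weighted
    ∑-bump x []            = ⊕-cong (1·-≋ (f x)) ≋-refl
    ∑-bump x ((n , y) ∷ t) with x ≟ y
    ... | yes refl = begin
      suc n · f x ⊕ ∑ t weighted        ≈⟨ ⊕-cong (suc·-≋ n (f x)) ≋-refl ⟩
      (f x ⊕ n · f x) ⊕ ∑ t weighted    ≈⟨ ⊕-assoc (f x) (n · f x) (∑ t weighted) ⟩
      f x ⊕ (n · f x ⊕ ∑ t weighted)    ∎
    ... | no _ = begin
      n · f y ⊕ ∑ (bump x t) weighted   ≈⟨ ⊕-cong ≋-refl (∑-bump x t) ⟩
      n · f y ⊕ (f x ⊕ ∑ t weighted)    ≈⟨ x∙yz≈y∙xz (n · f y) (f x) (∑ t weighted) ⟩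
      f x ⊕ (n · f y ⊕ ∑ t weighted)    ∎
      where open CommutativeSemigroupProperties Ring.+-commutativeSemigroup using (x∙yz≈y∙xz)

    ∑-zeros : ∀ xs → ∑ (map (0 ,_) xs) weighted ≋ con 0ℚ
    ∑-zeros []       = ≋-refl
    ∑-zeros (x ∷ xs) = ≋-trans (⊕-cong (⊗-zeroˡ (f x)) (∑-zeros xs)) (⊕-idˡ (con 0ℚ))

    -- Each `bump` adds one term to the weighted sum, whether it raises an entry or appends a new
    -- one, and the seeds contribute zero. So any seed list `xs` gives the same sum.
    ∑-tally : ∀ {I : Set} (key : I → A) is xs →
              ∑ (foldr (bump ∘ key) (map (0 ,_) xs) is) weighted ≋ ∑ is (f ∘ key)
    ∑-tally key []       xs = ∑-zeros xs
    ∑-tally key (i ∷ is) xs = ≋-trans (∑-bump (key i) (foldr (bump ∘ key) (map (0 ,_) xs) is))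
                                      (⊕-cong ≋-refl (∑-tally key is xs))

-- Sums and products without units, associated to the left

module _ {c ℓ} (M : Monoid c ℓ) where
  open Monoid M renaming (refl to ≈-refl; trans to ≈-trans; sym to ≈-sym)

  foldl₁ : List Carrier → Carrier
  foldl₁ []       = ε
  foldl₁ (x ∷ xs) = foldl _∙_ x xs

  foldl-foldr : ∀ x xs → foldl _∙_ x xs ≈ x ∙ foldr _∙_ ε xs
  foldl-foldr x []       = ≈-sym (identityʳ x)
  foldl-foldr x (y ∷ ys) = ≈-trans (foldl-foldr (x ∙ y) ys) (assoc x y (foldr _∙_ ε ys))

  foldl₁-foldr : ∀ xs → foldl₁ xs ≈ foldr _∙_ ε xs
  foldl₁-foldr []       = ≈-refl
  foldl₁-foldr (x ∷ xs) = foldl-foldr x xs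

leftSum leftProduct : List ℚ[a] → ℚ[a]
leftSum     = foldl₁ Ring.+-monoid
leftProduct = foldl₁ Ring.*-monoid

multiple : ℕ → ℚ[a] → ℚ[a]
multiple 1 p = p
multiple n p = n · p

multiple-≋ : ∀ n p → multiple n p ≋ n · p
multiple-≋ 0             p = ≋-refl
multiple-≋ 1             p = ≋-sym (1·-≋ p)
multiple-≋ (suc (suc n)) p = ≋-refl

power : ℚ[a] → ℕ → ℚ[a]
power p 1 = p
power p n = p ^ n

power-≋ : ∀ p n → power p n ≋ p ^ n
power-≋ p 0             = ≋-refl
power-≋ p 1             = ≋-sym (Ring.*-identityʳ p)
power-≋ p (suc (suc n)) = ≋-refl

powers : (ℕ → ℕ) → List ℕ → List ℚ[a]
powers g []           = []
powers g (zero  ∷ es) = powers (g ∘ suc) es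
powers g (suc e ∷ es) = power (a (suc (g 0))) (suc e) ∷ powers (g ∘ suc) es

foldr-powers : ∀ g es → foldr _⊗_ (con 1ℚ) (powers g es) ≋ monomial g es
foldr-powers g []           = ≋-refl
foldr-powers g (zero  ∷ es) = ≋-trans (foldr-powers (g ∘ suc) es) (≋-sym (⊗-idˡ _))
foldr-powers g (suc e ∷ es) = ⊗-cong (power-≋ (a (suc (g 0))) (suc e)) (foldr-powers (g ∘ suc) es)

-- Coefficients and exponents equal to 1 and absent variables are left out, so that closed instances
-- evaluate to terms exactly as they are written in the final polynomial.
reducedTerm : ℕ × List ℕ → ℚ[a]
reducedTerm (n , es) = multiple n (leftProduct (powers id es))

reducedTerm-≋ : ∀ n es → reducedTerm (n , es) ≋ n · monomial id es
reducedTerm-≋ n es = begin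
  multiple n (leftProduct (powers id es)) ≈⟨ multiple-≋ n _ ⟩
  n · leftProduct (powers id es)          ≈⟨ ⊗-cong ≋-refl (foldl₁-foldr Ring.*-monoid (powers id es)) ⟩
  n · foldr _⊗_ (con 1ℚ) (powers id es)   ≈⟨ ⊗-cong ≋-refl (foldr-powers id es) ⟩
  n · monomial id es                      ∎

-- The cycle index from tallied cycle types

_≟ᴸ_ : DecidableEquality (List ℕ)
_≟ᴸ_ = List.≡-dec ℕ._≟_

value : ℕ × List ℕ → ℚ[a]
value = weighted _≟ᴸ_ (monomial id)

leftSum-reducedTerms : ∀ ts → leftSum (map reducedTerm ts) ≋ ∑ ts value
leftSum-reducedTerms ts = ≋-trans (foldl₁-foldr Ring.+-monoid (map reducedTerm ts)) (go ts)
  where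
  go : ∀ ts → foldr _⊕_ (con 0ℚ) (map reducedTerm ts) ≋ ∑ ts value
  go []              = ≋-refl
  go ((n , es) ∷ ts) = ⊕-cong (reducedTerm-≋ n es) (go ts)

-- Seeding the tally with zeros fixes the order of its entries.
tally : ∀ {p} → List ℕ → List (Permutation′ p) → List (List ℕ) → List (ℕ × List ℕ)
tally codes αs types =
  foldr (bump _≟ᴸ_ ∘ multiplicities (length codes) ∘ cycleLengths codes) (map (0 ,_) types) αs

∑-induced : ∀ r {p} (αs : List (Permutation′ p)) types →
            ∑ (map (induced r) αs) (cycleMonomial (Subsets r p)) ≋ ∑ (tally (codes r p) αs types) value
∑-induced r {p} αs types = begin
  ∑ (map (induced r) αs) F               ≡⟨ List.foldr-map (λ α → F α ⊕_) (induced r) (con 0ℚ) αs ⟩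
  ∑ αs (F ∘ induced r)                   ≡⟨ List.foldr-cong (λ α q → cong (_⊕ q) (F-induced α)) refl αs ⟩
  ∑ αs (monomial id ∘ type)              ≈⟨ ∑-tally _≟ᴸ_ (monomial id) type αs types ⟨
  ∑ (tally (codes r p) αs types) value   ∎
  where
  F : FiniteSet.Permutation (Subsets r p) → ℚ[a]
  F = cycleMonomial (Subsets r p)

  type : Permutation′ p → List ℕ
  type = multiplicities (length (codes r p)) ∘ cycleLengths (codes r p)

  F-induced : ∀ α → F (induced r α) ≡ monomial id (type α)
  F-induced α = trans (cycleMonomial≡ (Subsets r p) (induced r α))
    (cong (monomial id) (cong₂ multiplicities
      (sym (List.length-map (code ∘ proj₁) (allSubsets r p))) (cycleLengths-induced r α)))

-- Order and sum are both transported to the list `L`, on which they can be computed without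
-- evaluating the deduplication.
Z-≋ : ∀ {X} (A : PermutationGroup X) {L q m} .{{_ : NonZero m}} →
      PermutationGroup.elements A ≡ L → length L ≡ m → ∑ L (cycleMonomial X) ≋ q →
      Z A ≋ (+ 1 / m) • q
Z-≋ {X} A elements≡L length≡m ∑≋q = ⊗-cong
  (Ring.reflexive (cong con (ℚ./-cong {p₁ = + 1} refl (trans (cong length elements≡L) length≡m))))
  (≋-trans (Ring.reflexive (cong (λ xs → ∑ xs (cycleMonomial X)) elements≡L)) ∑≋q)
  where open PermutationGroup A using (order≢0)

-- Each cycle type is entered as the partition of 35 formed by its cycle lengths.
cycleTypes : List (ℕ × List ℕ)
cycleTypes = map (map₂ (multiplicities 35))
  ( (1   , replicate 35 1)
  ∷ (21  , replicate 15 1 ++ replicate 10 2)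
  ∷ (105 , replicate 7 1 ++ replicate 14 2)
  ∷ (70  , replicate 5 1 ++ replicate 10 3)
  ∷ (105 , replicate 3 1 ++ replicate 16 2)
  ∷ (420 , replicate 3 1 ++ replicate 1 2 ++ replicate 4 3 ++ replicate 3 6)
  ∷ (280 , replicate 2 1 ++ replicate 11 3)
  ∷ (420 , replicate 1 1 ++ replicate 1 4 ++ replicate 1 6 ++ replicate 2 12)
  ∷ (840 , replicate 1 1 ++ replicate 3 2 ++ replicate 7 4)
  ∷ (210 , replicate 1 1 ++ replicate 2 2 ++ replicate 2 3 ++ replicate 4 6)
  ∷ (504 , replicate 3 5 ++ replicate 2 10)
  ∷ (840 , replicate 1 2 ++ replicate 1 3 ++ replicate 5 6)
  ∷ (504 , replicate 7 5)
  ∷ (720 , replicate 5 7)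
  ∷ [])

-- Adding to `i` two of the five points other than `i` and `h` gives a separating subset; here a
-- search over all pairs finds one.
3-subsets-separate : ∀ i h → i ≢ h → Separated 3 7 i h
3-subsets-separate = toWitness
  {a? = Fin.all? λ i → Fin.all? λ h → ¬? (i Fin.≟ h) →-dec separated? 3 7 i h} _

-- Evaluation over all of S₇. A type missing from `cycleTypes` would have been appended as an extra
-- entry, so the equality also confirms that no other type occurs.
tally-S₇ : tally (codes 3 7) (S 7) (map proj₂ cycleTypes) ≡ cycleTypes
tally-S₇ = toWitness
  {a? = List.≡-dec (Product.≡-dec ℕ._≟_ _≟ᴸ_) (tally (codes 3 7) (S 7) (map proj₂ cycleTypes)) cycleTypes} _

∑-cycleTypes : ∑ (map (induced 3) (S 7)) (cycleMonomial (Subsets 3 7)) ≋ leftSum (map reducedTerm cycleTypes)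
∑-cycleTypes = begin
  ∑ (map (induced 3) (S 7)) (cycleMonomial (Subsets 3 7))      ≈⟨ ∑-induced 3 (S 7) (map proj₂ cycleTypes) ⟩
  ∑ (tally (codes 3 7) (S 7) (map proj₂ cycleTypes)) value     ≡⟨ cong (λ t → ∑ t value) tally-S₇ ⟩
  ∑ cycleTypes value                                           ≈⟨ leftSum-reducedTerms cycleTypes ⟨
  leftSum (map reducedTerm cycleTypes)                         ∎

mainTheorem3 :
  Z (3 -groupOfS 7) ≋
    (+ 1 / (7 !)) •
      (     a 1 ^ 35
      ⊕  21 · a 1 ^ 15 ⊗ a 2 ^ 10
      ⊕ 105 · a 1 ^ 7 ⊗ a 2 ^ 14
      ⊕  70 · a 1 ^ 5 ⊗ a 3 ^ 10
      ⊕ 105 · a 1 ^ 3 ⊗ a 2 ^ 16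
      ⊕ 420 · a 1 ^ 3 ⊗ a 2 ⊗ a 3 ^ 4 ⊗ a 6 ^ 3
      ⊕ 280 · a 1 ^ 2 ⊗ a 3 ^ 11
      ⊕ 420 · a 1 ⊗ a 4 ⊗ a 6 ⊗ a 12 ^ 2
      ⊕ 840 · a 1 ⊗ a 2 ^ 3 ⊗ a 4 ^ 7
      ⊕ 210 · a 1 ⊗ a 2 ^ 2 ⊗ a 3 ^ 2 ⊗ a 6 ^ 4
      ⊕ 504 · a 5 ^ 3 ⊗ a 10 ^ 2
      ⊕ 840 · a 2 ⊗ a 3 ⊗ a 6 ^ 5
      ⊕ 504 · a 5 ^ 7
      ⊕ 720 · a 7 ^ 5 )
-- By evaluation, `S 7` has 7! entries, which is the `refl`, and the left-nested sum of reduced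
-- terms is the polynomial displayed above.
mainTheorem3 = Z-≋ (3 -groupOfS 7) (inducedPermutations≡ 3-subsets-separate) refl ∑-cycleTypes
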